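{- Consider an instance on proper intervals with capacity $m$. In every canonical schedule, for every boundary $h\in\mathbb{Z}$, at most $2m-1$ jobs are split at $h$.
   Context: Active-time scheduling: jobs $J=\{1,\dots,n\}$, where job $j$ has an integer release time $r_j$, integer deadline $d_j$, positive integer processing time $p_j$ and nonnegative weight $w_j$; a positive integer capacity $m$ and an integer active-time budget $K$. The window of $j$ is the set of integer slots $W_j=\{r_j,\dots,d_j\}$. A feasible schedule assigns to each integer slot $t$ a set $A(t)\subseteq J$ with $|A(t)|\le m$ of jobs processed (one unit each) in slot $t$, where $j\in A(t)$ implies $t\in W_j$, and at most $K$ slots $t$ have $A(t)\neq\emptyset$. It is assumed that a schedule processes a job if and only if it completes it, i.e. a processed job $j$ appears in exactly $p_j$ of the sets $A(t)$; jobs with $p_j>K$ are discarded. The instance is on proper intervals if no window strictly contains another; jobs are indexed by nondecreasing release time (ties broken arbitrarily), so that $i<j$ implies $r_i\le r_j$ and $d_i\le d_j$. For jobs $i<j$, the pair $(i,j)$ is an inversion pair if there are slots $t<t'$ with $j\in A(t)$, $i\notin A(t)$, $i\in A(t')$, $j\notin A(t')$. A schedule is canonical if it is feasible and has no inversion pairs. Boundary $h$ is the point immediately after slot $h$; a job is split at boundary $h$ if it is processed both in some slot $t\le h$ and in some slot $t\ge h+1$. -}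

module Defs where

open import Data.Fin as Fin using (Fin)
open import Data.Fin.Subset using (Subset; _∈_; _∉_; ∣_∣; Nonempty)
open import Data.Integer as ℤ using (ℤ; +_)
open import Data.List using (List; length)
import Data.List.Membership.Propositional as List
open import Data.List.Relation.Unary.All using (All)
open import Data.List.Relation.Unary.Unique.Propositional using (Unique)
open import Data.Nat as ℕ using (ℕ)
open import Data.Product using (∃-syntax; _×_)
open import Function.Bundles using (_⇔_)
open import Level using (Level; _⊔_; 0ℓ)
open import Relation.Binary.Bundles using (Poset)
open import Relation.Binary.PropositionalEquality using (_≡_)
open import Relation.Nullary using (¬_)
open import Relation.Unary using (Pred; _⊂_)

private
  variable
    a ℓ c ℓ₁ ℓ₂ : Level
    n : ℕ

-- Lists without repetition play the role of finite subsets of a possibly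
-- infinite type (slots range over all of ℤ).  The bound is an integer because
-- the budget is one.
AtMost : {A : Set a} → ℤ → Pred A ℓ → Set (a ⊔ ℓ)
AtMost k P = ∀ xs → Unique xs → All P xs → + length xs ℤ.≤ k

Exactly : {A : Set a} → ℕ → Pred A ℓ → Set (a ⊔ ℓ)
Exactly {A = A} k P =
  ∃[ xs ] Unique xs × (∀ (x : A) → x List.∈ xs ⇔ P x) × length xs ≡ k

-- The number domain of the weights is left open: any partially ordered type
-- with a distinguished zero.
record Instance (W : Poset c ℓ₁ ℓ₂) (0w : Poset.Carrier W) (n : ℕ) : Set (c ⊔ ℓ₂) where
  field
    release    : Fin n → ℤ
    deadline   : Fin n → ℤ
    processing : Fin n → ℕ
    weight     : Fin n → Poset.Carrier W
    capacity   : ℕ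
    budget     : ℤ
    processing-positive : ∀ j → 0 ℕ.< processing j
    weight-nonnegative  : ∀ j → Poset._≤_ W 0w (weight j)
    capacity-positive   : 0 ℕ.< capacity
    -- Jobs too long for the budget have been discarded.
    processing≤budget   : ∀ j → + processing j ℤ.≤ budget

  window : Fin n → Pred ℤ 0ℓ
  window j t = release j ℤ.≤ t × t ℤ.≤ deadline j

  -- With nonempty windows, the two fields together force deadlines to be
  -- nondecreasing in the job index as well.
  record ProperIntervals : Set where
    field
      proper        : ∀ i j → ¬ (window i ⊂ window j)
      release-order : ∀ i j → i Fin.< j → release i ℤ.≤ release j

Schedule : ℕ → Set
Schedule n = ℤ → Subset n

module _ {W : Poset c ℓ₁ ℓ₂} {0w : Poset.Carrier W} (I : Instance W 0w n) where
  open Instance I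

  record Feasible (A : Schedule n) : Set where
    field
      within-capacity : ∀ t → ∣ A t ∣ ℕ.≤ capacity
      within-window   : ∀ t j → j ∈ A t → window j t
      within-budget   : AtMost budget (λ t → Nonempty (A t))
      completes       : ∀ j → (∃[ t ] j ∈ A t) → Exactly (processing j) (λ t → j ∈ A t)

InversionPair : Schedule n → Fin n → Fin n → Set
InversionPair A i j = i Fin.< j × ∃[ t ] ∃[ t′ ]
  (t ℤ.< t′ × j ∈ A t × i ∉ A t × i ∈ A t′ × j ∉ A t′)

record Canonical {W : Poset c ℓ₁ ℓ₂} {0w : Poset.Carrier W}
                 (I : Instance W 0w n) (A : Schedule n) : Set where
  field
    feasible      : Feasible I A
    no-inversions : ∀ i j → ¬ InversionPair A i j

SplitAt : Schedule n → ℤ → Pred (Fin n) 0ℓ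
SplitAt A h j =
  (∃[ t ] (t ℤ.≤ h × j ∈ A t)) × (∃[ t ] (h ℤ.+ + 1 ℤ.≤ t × j ∈ A t))

{-# OPTIONS --safe #-}

-- For split jobs i < j, the absence of inversions means that every slot of j
-- up to h also processes i, or every slot of i after h also processes j.  Hence
-- there is a split job x whose slots up to h process all smaller split jobs
-- and whose slots after h process all larger ones.  One slot of x on each side
-- of h then covers all split jobs, and x is counted twice.
module Submission where

open import Defs
open import Data.Fin as Fin using (Fin; zero; suc)
import Data.Fin.Properties as Fin
open import Data.Fin.Subset using (Subset; _∈_; ∣_∣) renaming (_-_ to _∖_)
open import Data.Fin.Subset.Properties
  using (_∈?_; x∈p∧x≢y⇒x∈p-y; x∈p⇒∣p-x∣<∣p∣)
open import Data.Integer as ℤ using (ℤ; +_; _*_; _-_)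
import Data.Integer.Properties as ℤ
open import Data.List using ([]; _∷_; length)
import Data.List.Membership.DecPropositional as DecMembership
import Data.List.Membership.Propositional as List
open import Data.List.Relation.Unary.All as All using (All; []; _∷_)
open import Data.List.Relation.Unary.AllPairs using ([]; _∷_)
open import Data.List.Relation.Unary.Any using (here)
open import Data.List.Relation.Unary.Unique.Propositional using (Unique)
open import Data.Nat as ℕ using (ℕ; z≤n; s≤s)
import Data.Nat.Properties as ℕ
open import Data.Product using (_×_; _,_; ∃-syntax; proj₁; proj₂)
open import Data.Sum as Sum using (_⊎_; inj₁; inj₂)
open import Function.Base using (_∘_; _on_)
open import Function.Bundles using (Equivalence)
open import Level using (0ℓ)
open import Relation.Binary.Bundles using (Poset)
open import Relation.Binary.Core using (Rel)
open import Relation.Binary.Definitions using (Reflexive; Transitive)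
open import Relation.Binary.PropositionalEquality using (refl; sym; cong; subst)
open import Relation.Nullary using (¬_; Dec; yes; no; contradiction)
open import Relation.Nullary.Decidable using (map′; _→-dec_)
open import Relation.Unary using (Pred; Decidable)

-- Induction adding a new smallest element 0 to a set with pivot x: either L x 0
-- and x remains a pivot, or R 0 k for every k, since for k ≤ x the relation
-- L k 0 would give L x 0.
pivot : ∀ {n} {P : Pred (Fin n) 0ℓ} {L R : Rel (Fin n) 0ℓ} →
        Decidable P → (∀ {j} i → P j → Dec (L j i)) →
        Reflexive L → Transitive L → Reflexive R → Transitive R →
        (∀ {i j} → i Fin.< j → P i → P j → ¬ L j i → R i j) →
        ∃[ j ] P j →
        ∃[ x ] P x × (∀ k → P k → (k Fin.≤ x → L x k) × (x Fin.≤ k → R x k))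
pivot {ℕ.suc n} P? L? L-refl L-trans R-refl R-trans dichotomy _
  with Fin.any? (P? ∘ suc)
pivot {ℕ.suc n} P? L? L-refl L-trans R-refl R-trans dichotomy (zero , p₀)
  | no ∄suc = zero , p₀ , λ where
      zero    _  → (λ _ → L-refl) , (λ _ → R-refl)
      (suc k) pk → contradiction (k , pk) ∄suc
pivot {ℕ.suc n} P? L? L-refl L-trans R-refl R-trans dichotomy (suc j , pj)
  | no ∄suc = contradiction (j , pj) ∄suc
pivot {ℕ.suc n} {P} {L} {R} P? L? L-refl L-trans R-refl R-trans dichotomy _
  | yes ∃suc
  with pivot {P = P ∘ suc} {L = L on suc} {R = R on suc}
             (P? ∘ suc) (L? ∘ suc) L-refl L-trans R-refl R-trans
             (dichotomy ∘ s≤s) ∃suc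
... | x , px , x-pivot with P? zero
...   | no ¬p₀ = suc x , px , λ where
        zero    p₀ → contradiction p₀ ¬p₀
        (suc k) pk → proj₁ (x-pivot _ pk) ∘ ℕ.s≤s⁻¹
                   , proj₂ (x-pivot _ pk) ∘ ℕ.s≤s⁻¹
...   | yes p₀ with L? zero px
...     | yes Lx0 = suc x , px , λ where
          zero    _  → (λ _ → Lx0) , (λ ())
          (suc k) pk → proj₁ (x-pivot _ pk) ∘ ℕ.s≤s⁻¹
                     , proj₂ (x-pivot _ pk) ∘ ℕ.s≤s⁻¹
...     | no ¬Lx0 = zero , p₀ , λ where
          zero    _  → (λ _ → L-refl) , (λ _ → R-refl)
          (suc k) pk → (λ ()) , (λ _ → R0 pk)
  where
  R0 : ∀ {k} → P (suc k) → R zero (suc k)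
  R0 {k} pk with Fin.≤-total k x
  ... | inj₁ k≤x = dichotomy (s≤s z≤n) p₀ pk (¬Lx0 ∘ L-trans (proj₁ (x-pivot _ pk) k≤x))
  ... | inj₂ x≤k = R-trans (dichotomy (s≤s z≤n) p₀ px ¬Lx0) (proj₂ (x-pivot _ pk) x≤k)

-- Each listed element is charged to one of the two sets and deleted from it. Uniqueness keeps the
-- rest of the list covered after the deletion, and the deletion lowers that cardinality, which pays
-- for the element.
unique⇒length≤∣p∣+∣q∣ : ∀ {n} {p q : Subset n} {xs} → Unique xs →
                        All (λ x → x ∈ p ⊎ x ∈ q) xs → length xs ℕ.≤ ∣ p ∣ ℕ.+ ∣ q ∣
unique⇒length≤∣p∣+∣q∣ [] [] = z≤n
unique⇒length≤∣p∣+∣q∣ {q = q} (x≢xs ∷ xs!) (inj₁ x∈p ∷ xs∈) = ℕ.≤-<-trans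
  (unique⇒length≤∣p∣+∣q∣ xs! (All.zipWith
    (λ (x≢y , y∈) → Sum.map₁ (λ y∈p → x∈p∧x≢y⇒x∈p-y y∈p (x≢y ∘ sym)) y∈) (x≢xs , xs∈)))
  (ℕ.+-monoˡ-< ∣ q ∣ (x∈p⇒∣p-x∣<∣p∣ x∈p))
unique⇒length≤∣p∣+∣q∣ {p = p} (x≢xs ∷ xs!) (inj₂ x∈q ∷ xs∈) = ℕ.≤-<-trans
  (unique⇒length≤∣p∣+∣q∣ xs! (All.zipWith
    (λ (x≢y , y∈) → Sum.map₂ (λ y∈q → x∈p∧x≢y⇒x∈p-y y∈q (x≢y ∘ sym)) y∈) (x≢xs , xs∈)))
  (ℕ.+-monoʳ-< ∣ p ∣ (x∈p⇒∣p-x∣<∣p∣ x∈q))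

l<m+m⇒l≤2m-1 : ∀ {l} m → l ℕ.< m ℕ.+ m → + l ℤ.≤ + 2 * + m - + 1
l<m+m⇒l≤2m-1 {l} (ℕ.suc m) (s≤s l≤) =
  -- With the capacity a successor, the right-hand side computes to `m + suc (m + 0)`; only the
  -- trailing zero has to be matched.
  ℤ.+≤+ (subst (λ k → l ℕ.≤ m ℕ.+ k) (cong ℕ.suc (sym (ℕ.+-identityʳ m))) l≤)

-- For fixed `T` this is a preorder on jobs. The slots up to `h` and the slots after `h` give the
-- two relations passed to `pivot`.
Covers : ∀ {n} → Schedule n → Pred ℤ 0ℓ → Rel (Fin n) 0ℓ
Covers A T x k = ∀ t → T t → x ∈ A t → k ∈ A t

module _ {c ℓ₁ ℓ₂} {W : Poset c ℓ₁ ℓ₂} {0w : Poset.Carrier W} {n : ℕ}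
         (I : Instance W 0w n) (A : Schedule n) where

  open Instance I

  -- The quantifier over all integer slots reduces to the finite list of slots of `x` that
  -- `completes` supplies. That list exists only for a processed job, hence the last argument.
  covers? : Feasible I A → ∀ {T} → Decidable T →
            ∀ {x} k → ∃[ t ] x ∈ A t → Dec (Covers A T x k)
  covers? feasible T? k x-processed
    with ts , _ , ∈ts⇔ , _ ← Feasible.completes feasible _ x-processed =
    map′ (λ all t Tt x∈ → All.lookup all (Equivalence.from (∈ts⇔ _) x∈) Tt)
         (λ cov → All.tabulate λ t∈ Tt → cov _ Tt (Equivalence.to (∈ts⇔ _) t∈))
         (All.all? (λ t → T? t →-dec (k ∈? A t)) ts)

  module _ (canonical : Canonical I A) (h : ℤ) where

    open Canonical canonical
    open Feasible feasible

    Before After : Pred ℤ 0ℓ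
    Before t = t ℤ.≤ h
    After  t = h ℤ.+ + 1 ℤ.≤ t

    before<after : ∀ {t t′} → Before t → After t′ → t ℤ.< t′
    before<after t≤h h<t′ = ℤ.≤-<-trans t≤h
      (ℤ.suc[i]≤j⇒i<j (subst (ℤ._≤ _) (ℤ.+-comm h (+ 1)) h<t′))

    -- A single slot of `i` after `h` that lacks `j` would form an inversion with any slot of `j` up
    -- to `h` that lacks `i`. Such a slot therefore forces the covering before `h` that is assumed
    -- to fail.
    no-inversion⇒covers : ∀ {i j} → i Fin.< j →
                          ¬ Covers A Before j i → Covers A After i j
    no-inversion⇒covers {i} {j} i<j ¬cov t′ h<t′ i∈t′ with j ∈? A t′
    ... | yes j∈t′ = j∈t′
    ... | no  j∉t′ = contradiction cov ¬cov
      where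
      cov : Covers A Before j i
      cov t t≤h j∈t with i ∈? A t
      ... | yes i∈t = i∈t
      ... | no  i∉t = contradiction
        (i<j , t , t′ , before<after t≤h h<t′ , j∈t , i∉t , i∈t′ , j∉t′)
        (no-inversions i j)

    split-jobs<2m : ∀ xs → Unique xs → All (SplitAt A h) xs →
                    length xs ℕ.< capacity ℕ.+ capacity
    -- Without split jobs there is no pivot; strictness comes from the positive capacity instead.
    split-jobs<2m [] _ _ = ℕ.m≤n⇒m≤n+o capacity capacity-positive
    split-jobs<2m xs@(y ∷ _) xs! split
      with pivot {P = List._∈ xs} {L = Covers A Before} {R = Covers A After}
             (λ j → DecMembership._∈?_ Fin._≟_ j xs)
             -- A split job has a slot up to `h`, so it is processed and its coverings are
             -- decidable.
             (λ i j∈xs → let ((t , _ , j∈t) , _) = All.lookup split j∈xs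
                         in covers? feasible (ℤ._≤? h) i (t , j∈t))
             (λ _ _ x∈ → x∈) (λ f g t Tt → g t Tt ∘ f t Tt)
             (λ _ _ x∈ → x∈) (λ f g t Tt → g t Tt ∘ f t Tt)
             (λ i<j _ _ → no-inversion⇒covers i<j)
             (y , here refl)
    ... | x , x∈xs , x-pivot
      with (t , t≤h , x∈t) , (t′ , h<t′ , x∈t′) ← All.lookup split x∈xs =
      ℕ.<-≤-trans
        (ℕ.≤-<-trans (unique⇒length≤∣p∣+∣q∣ xs! (All.tabulate covered))
                     -- The pivot lies in both slots but is needed only in `A t`; deleting it from
                     -- `A t′` makes the bound strict.
                     (ℕ.+-monoʳ-< ∣ A t ∣ (x∈p⇒∣p-x∣<∣p∣ x∈t′)))
        (ℕ.+-mono-≤ (within-capacity t) (within-capacity t′))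
      where
      covered : ∀ {k} → k List.∈ xs → k ∈ A t ⊎ k ∈ A t′ ∖ x
      -- The tie `k = x` falls to the slot before the boundary, so every job sent to `A t′` differs
      -- from `x` and survives the deletion.
      covered {k} k∈xs with ℕ.≤-<-connex (Fin.toℕ k) (Fin.toℕ x)
      ... | inj₁ k≤x = inj₁ (proj₁ (x-pivot _ k∈xs) k≤x t t≤h x∈t)
      ... | inj₂ x<k = inj₂ (x∈p∧x≢y⇒x∈p-y
        (proj₂ (x-pivot _ k∈xs) (ℕ.<⇒≤ x<k) t′ h<t′ x∈t′) (Fin.<⇒≢ x<k ∘ sym))

lemma7 : ∀ {c ℓ₁ ℓ₂} {W : Poset c ℓ₁ ℓ₂} {0w : Poset.Carrier W} {n : ℕ}
    (I : Instance W 0w n) → Instance.ProperIntervals I →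
    (A : Schedule n) → Canonical I A →
    (h : ℤ) → AtMost (+ 2 * + Instance.capacity I - + 1) (SplitAt A h)
lemma7 I _ A canonical h xs xs! split =
  l<m+m⇒l≤2m-1 (Instance.capacity I) (split-jobs<2m I A canonical h xs xs! split)
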